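{- Let $n,b$ be integers with $1<n<b$, let $C$ be an $(n,b)$-permutiple class, and let $G_C$ be its graph. The following statements are equivalent: (1) $\overline{G}_C$ is the graph of a permutiple class, i.e. there is an $(n,b)$-permutiple $q$ with $G_q=\overline{G}_C$; (2) the state $0$ is a vertex of $\overline{\Gamma}_C$; (3) the state $n-1$ is a vertex of $\Gamma_C$.
   Context: For digits $0\le d_j<b$, $(d_k,\ldots,d_0)_b$ denotes $\sum_{j=0}^k d_jb^j$ (leading zero digits allowed). For a permutation $\sigma$ of $\{0,\ldots,k\}$, $(d_k,\ldots,d_0)_b$ is an $(n,b,\sigma)$-permutiple if $(d_k,\ldots,d_0)_b=n\cdot(d_{\sigma(k)},\ldots,d_{\sigma(0)})_b$, and an $(n,b)$-permutiple if this holds for some $\sigma$. The graph $G_p$ of such a $p$ is the directed graph with vertex set $\{0,\ldots,b-1\}$ and edge set $\{(d_j,d_{\sigma(j)})\mid 0\le j\le k\}$. The class of an $(n,b)$-permutiple $p$ is the set $C$ of all $(n,b)$-permutiples $q$ with $G_q$ a subgraph of $G_p$; its graph is $G_C=G_p$. For a digit $d$ put $\overline d=b-1-d$, for a state $c\in\{0,\ldots,n-1\}$ put $\overline c=n-1-c$. The reflection $\overline{G}$ of a directed graph $G$ on $\{0,\ldots,b-1\}$ has the same vertices and edges $(\overline{d}_1,\overline{d}_2)$ for edges $(d_1,d_2)$ of $G$. Let $\lambda(x)$ be the least non-negative residue of $x$ mod $b$; the mother graph $M$ is the directed graph on $\{0,\ldots,b-1\}$ with edges the pairs $(d_1,d_2)$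 with $\lambda(d_1+(b-n)d_2)\le n-1$. The Hoey-Sloane graph $\Gamma$ is the edge-labelled directed graph on states $\{0,\ldots,n-1\}$ in which $(c_1,c_2)$ is an edge labelled by every edge $(d_1,d_2)$ of $M$ with $n d_2-d_1+c_1=bc_2$ (an edge exists iff there is at least one such label). The cycle image of a directed cycle $C_0$ of $M$ is the edge-labelled subgraph of $\Gamma$ with edges the $(c_1,c_2)$ for which $\{(d_1,d_2)\in C_0\mid n d_2-d_1+c_1=bc_2\}$ is nonempty, labelled by this set, and vertices the endpoints of these edges. $\Gamma_C$ is the union (of vertices, edges and labels) of the cycle images of the directed cycles of $M$ contained in $G_C$. The reflection $\overline{\Gamma}_C$ has vertices $\overline{c}$, edges $(\overline{c}_1,\overline{c}_2)$ and labels $(\overline{d}_1,\overline{d}_2)$ for the vertices $c$, edges $(c_1,c_2)$ and labels $(d_1,d_2)$ of $\Gamma_C$. -}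

module Defs where

open import Level using (0ℓ)
open import Data.Nat using (ℕ; suc; _+_; _*_; _∸_; _^_; _≤_; NonZero)
open import Data.Nat.DivMod using (_%_; _mod_)
open import Data.Nat.Properties using (+-0-monoid)
import Data.Integer as ℤ
open import Data.Fin using (Fin; toℕ; opposite)
open import Data.Fin.Properties using (nonZeroIndex)
open import Data.Fin.Permutation using (Permutation′; _⟨$⟩ʳ_)
open import Data.Product using (_×_; _,_; ∃; ∃₂)
open import Data.Sum using (_⊎_)
open import Data.Vec.Functional using (Vector)
open import Algebra.Properties.Monoid.Sum +-0-monoid using (sum)
open import Function.Definitions using (Injective)
open import Relation.Binary.Core using (Rel)
  renaming (_⇒_ to _⊆ᴳ_; _⇔_ to _≐ᴳ_) public
open import Relation.Binary.PropositionalEquality using (_≡_)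
open import Relation.Unary using (Pred; U; _≐_)

Digit : ℕ → Set
Digit b = Fin b

State : ℕ → Set
State n = Fin n

-- A directed graph with vertex set all of V is its edge relation; `_⊆ᴳ_` is
-- then the subgraph relation and `_≐ᴳ_` equality of graphs.
Digraph : Set → Set₁
Digraph V = Rel V 0ℓ

-- `opposite d` is the element b - 1 - d of Fin b.
reflect : ∀ {b} → Digraph (Digit b) → Digraph (Digit b)
reflect G x y = ∃₂ λ d₁ d₂ → G d₁ d₂ × x ≡ opposite d₁ × y ≡ opposite d₂

-- The digit of weight b ^ j is the one at index j.
value : ∀ {b m} → Vector (Digit b) m → ℕ
value {b} d = sum λ j → toℕ (d j) * b ^ toℕ j

record Permutiple (n b : ℕ) : Set where
  field
    k     : ℕ
    digit : Vector (Digit b) (suc k)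
    σ     : Permutation′ (suc k)
    value≡n*permuted : value digit ≡ n * value (λ j → digit (σ ⟨$⟩ʳ j))

-- With repeated digits the graph depends on σ as well as on the digits, which
-- is why σ is part of the data of a permutiple.
graph : ∀ {n b} → Permutiple n b → Digraph (Digit b)
graph p d₁ d₂ = ∃ λ j → d₁ ≡ digit j × d₂ ≡ digit (σ ⟨$⟩ʳ j)
  where open Permutiple p

record PermutipleClass (n b : ℕ) : Set₁ where
  field
    members  : Pred (Permutiple n b) 0ℓ
    root     : Permutiple n b
    members≐ : members ≐ λ q → graph q ⊆ᴳ graph root

classGraph : ∀ {n b} → PermutipleClass n b → Digraph (Digit b)
classGraph C = graph (PermutipleClass.root C)

motherGraph : ∀ n b → Digraph (Digit b)
motherGraph n b d₁ d₂ = (toℕ d₁ + (b ∸ n) * toℕ d₂) % b ≤ n ∸ 1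
  where instance
    b≢0 : NonZero b
    b≢0 = nonZeroIndex d₁

next : ∀ {m} → Fin (suc m) → Fin (suc m)
next {m} i = suc (toℕ i) mod suc m

-- Cycles have no repeated vertices; a loop is a cycle of length one.
record DirectedCycle {V : Set} (G : Digraph V) : Set where
  field
    length-1  : ℕ
    vertexAt  : Vector V (suc length-1)
    distinct  : Injective _≡_ _≡_ vertexAt
    connected : ∀ i → G (vertexAt i) (vertexAt (next i))

cycleGraph : ∀ {V} {G : Digraph V} → DirectedCycle G → Digraph V
cycleGraph C₀ x y = ∃ λ i → x ≡ vertexAt i × y ≡ vertexAt (next i)
  where open DirectedCycle C₀

-- `label u v` is the set of labels carried by the edge (u , v).
record LabelledDigraph (V L : Set) : Set₁ where
  field
    vertex : Pred V 0ℓ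
    edge   : Rel V 0ℓ
    label  : V → V → Pred L 0ℓ

open LabelledDigraph public

StateGraph : ℕ → ℕ → Set₁
StateGraph n b = LabelledDigraph (State n) (Digit b × Digit b)

Transition : ∀ {n b} → State n → State n → Digit b × Digit b → Set
Transition {n} {b} c₁ c₂ (d₁ , d₂) =
  ℤ.+ n ℤ.* ℤ.+ toℕ d₂ ℤ.- ℤ.+ toℕ d₁ ℤ.+ ℤ.+ toℕ c₁ ≡ ℤ.+ b ℤ.* ℤ.+ toℕ c₂

hoeySloane : ∀ n b → StateGraph n b
hoeySloane n b = record
  { vertex = U
  ; edge   = λ c₁ c₂ → ∃ (labels c₁ c₂)
  ; label  = labels
  }
  where
  labels : State n → State n → Pred (Digit b × Digit b) 0ℓ
  labels c₁ c₂ (d₁ , d₂) = motherGraph n b d₁ d₂ × Transition c₁ c₂ (d₁ , d₂)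

cycleImage : ∀ {n b} → DirectedCycle (motherGraph n b) → StateGraph n b
cycleImage {n} {b} C₀ = record
  { vertex = λ c → ∃₂ λ c₁ c₂ → ∃ (labels c₁ c₂) × Endpoint c c₁ c₂
  ; edge   = λ c₁ c₂ → ∃ (labels c₁ c₂)
  ; label  = labels
  }
  where
  labels : State n → State n → Pred (Digit b × Digit b) 0ℓ
  labels c₁ c₂ (d₁ , d₂) =
    cycleGraph C₀ d₁ d₂ × label (hoeySloane n b) c₁ c₂ (d₁ , d₂)

  Endpoint : State n → State n → State n → Set
  Endpoint c c₁ c₂ = c ≡ c₁ ⊎ c ≡ c₂

⋃ᴳ : ∀ {V L} {I : Set} → (I → LabelledDigraph V L) → LabelledDigraph V L
⋃ᴳ G = record
  { vertex = λ v → ∃ λ i → vertex (G i) v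
  ; edge   = λ u v → ∃ λ i → edge (G i) u v
  ; label  = λ u v l → ∃ λ i → label (G i) u v l
  }

classStateGraph : ∀ {n b} → PermutipleClass n b → StateGraph n b
classStateGraph {n} {b} C = ⋃ᴳ {I = CycleIn} λ (C₀ , _) → cycleImage C₀
  where
  CycleIn : Set
  CycleIn = ∃ λ (C₀ : DirectedCycle (motherGraph n b)) →
            cycleGraph C₀ ⊆ᴳ classGraph C

reflectStates : ∀ {n b} → StateGraph n b → StateGraph n b
reflectStates Γ = record
  { vertex = λ c → ∃ λ c′ → vertex Γ c′ × c ≡ opposite c′
  ; edge   = λ c₁ c₂ → ∃₂ λ c₁′ c₂′ →
               edge Γ c₁′ c₂′ × c₁ ≡ opposite c₁′ × c₂ ≡ opposite c₂′
  ; label  = λ c₁ c₂ (d₁ , d₂) → ∃₂ λ c₁′ c₂′ → ∃₂ λ d₁′ d₂′ →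
               label Γ c₁′ c₂′ (d₁′ , d₂′)
               × (c₁ ≡ opposite c₁′ × c₂ ≡ opposite c₂′)
               × (d₁ ≡ opposite d₁′ × d₂ ≡ opposite d₂′)
  }

_isStateOf_ : ∀ {n b} → ℕ → StateGraph n b → Set
m isStateOf Γ = ∃ λ c → toℕ c ≡ m × vertex Γ c

{-# OPTIONS --safe #-}
module Submission where

-- The carries of the multiplication by n form, read cyclically, a closed walk
-- in Γ from 0 to 0 whose labels are the edges of G_C; since an edge of M labels
-- exactly one edge of Γ, these carries are exactly the vertices of Γ_C.
-- Reflection preserves transitions.  So if n - 1 is a carry, rotating the walk
-- to start there and reflecting it gives a closed walk from 0 to 0, that is, a
-- permutiple with graph the reflection of G_C.  Conversely, the initial carry 0
-- of a permutiple with reflected graph is the reflection of n - 1.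

open import Defs
open import Data.Nat
  using (ℕ; zero; suc; _+_; _*_; _∸_; _^_; _≤_; _<_; s≤s; NonZero)
open import Data.Nat.DivMod
  using (_%_; _/_; n%n≡0; m<n⇒m%n≡m; [m+kn]%n≡m%n; m≡m%n+[m/n]*n;
         m<n*o⇒m/o<n)
open import Data.Nat.GeneralisedArithmetic using (fold; fold-+)
open import Data.Nat.Properties
  using (*-identityʳ; *-identityˡ; *-zeroʳ; *-comm; *-cancelˡ-≡; *-monoʳ-≤;
         +-identityʳ; +-cancelˡ-≡; +-cancelʳ-≡; +-monoʳ-<; n∸n≡0; <-≤-trans; <⇒≤;
         m∸n+n≡m; m+[n∸m]≡n; m≤n⇒∃[o]m+o≡n; n<1+n; +-*-semiring)
open import Data.Nat.Tactic.RingSolver using (solve-∀)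
import Data.Integer as ℤ
import Data.Integer.Properties as ℤ
import Data.Integer.Tactic.RingSolver as ℤ
open import Data.Fin using (Fin; zero; suc; toℕ; fromℕ; fromℕ<; inject₁; opposite)
open import Data.Fin.Induction using (<-weakInduction)
open import Data.Fin.Permutation
  using (Permutation′; permutation; _⟨$⟩ʳ_; _⟨$⟩ˡ_; inverseʳ; id; flip; _∘ₚ_)
open import Data.Fin.Properties
  using (toℕ<n; toℕ≤pred[n]; toℕ-injective; toℕ-fromℕ; toℕ-fromℕ<; toℕ-inject₁;
         opposite-prop; opposite-involutive; suc-injective; nonZeroIndex;
         pigeonhole; any?; _≟_)
open import Data.Fin.Relation.Unary.Top using (view; ‵fromℕ; ‵inject₁)
open import Data.Product using (_×_; _,_; ∃; proj₁; proj₂)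
open import Data.Sum using (inj₁; inj₂)
open import Data.Vec.Functional using (Vector; tail)
open import Algebra.Properties.Semiring.Sum +-*-semiring
  using (sum; sum-cong-≗; *-distribˡ-sum)
open import Function using (_∘_)
open import Function.Bundles using (_⇔_; mk⇔; Injection)
open import Function.Definitions using (Injective)
open import Function.Properties.Equivalence using () renaming (trans to ⇔-trans; sym to ⇔-sym)
open import Function.Properties.Inverse using (↔⇒↣)
open import Relation.Binary.Construct.Closure.ReflexiveTransitive
  using (Star; ε; _◅_; _◅◅_)
open import Relation.Binary.Definitions using (DecidableEquality)
open import Relation.Binary.PropositionalEquality
open import Relation.Nullary using (yes; no; contradiction)

open ≡-Reasoning

private variable
  n b m : ℕ

-- Rotations of a cyclically indexed vector

next-inject₁ : (j : Fin m) → next (inject₁ j) ≡ suc j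
next-inject₁ {m} j = toℕ-injective (begin
  toℕ (next (inject₁ j))            ≡⟨ toℕ-fromℕ< _ ⟩
  suc (toℕ (inject₁ j)) % suc m     ≡⟨ cong (λ i → suc i % suc m) (toℕ-inject₁ j) ⟩
  suc (toℕ j) % suc m               ≡⟨ m<n⇒m%n≡m (s≤s (toℕ<n j)) ⟩
  suc (toℕ j)                       ∎)

next-fromℕ : ∀ m → next (fromℕ m) ≡ zero
next-fromℕ m = toℕ-injective (begin
  toℕ (next (fromℕ m))          ≡⟨ toℕ-fromℕ< _ ⟩
  suc (toℕ (fromℕ m)) % suc m   ≡⟨ cong (λ i → suc i % suc m) (toℕ-fromℕ m) ⟩
  suc m % suc m                 ≡⟨ n%n≡0 (suc m) ⟩
  0                             ∎)

prev : Fin (suc m) → Fin (suc m)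
prev zero    = fromℕ _
prev (suc i) = inject₁ i

next-prev : (i : Fin (suc m)) → next (prev i) ≡ i
next-prev zero    = next-fromℕ _
next-prev (suc i) = next-inject₁ i

prev-next : (i : Fin (suc m)) → prev (next i) ≡ i
prev-next i with view i
... | ‵fromℕ     = cong prev (next-fromℕ _)
... | ‵inject₁ j = cong prev (next-inject₁ j)

-- Each increment of `r` costs one further application of `next`. Commutation with `next` keeps a
-- cyclic chain of carries a chain after re-indexing.
rotation : (r : Fin (suc m)) → ∃ λ (ρ : Permutation′ (suc m)) →
           ρ ⟨$⟩ʳ zero ≡ r × ∀ i → ρ ⟨$⟩ʳ next i ≡ next (ρ ⟨$⟩ʳ i)
rotation = <-weakInduction _ (id , refl , λ _ → refl)
  λ { i (ρ , ρ0≡i , ρ-next) →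
      ρ ∘ₚ permutation next prev next-prev prev-next
    , trans (cong next ρ0≡i) (next-inject₁ i)
    , cong next ∘ ρ-next }

-- Cycles through an edge

record SimplePath {V : Set} (G : Digraph V) (u v : V) : Set where
  field
    {length}  : ℕ
    vertexAt  : Vector V (suc length)
    first     : vertexAt zero ≡ u
    last      : vertexAt (fromℕ length) ≡ v
    distinct  : Injective _≡_ _≡_ vertexAt
    connected : ∀ i → G (vertexAt (inject₁ i)) (vertexAt (suc i))

module _ {V : Set} {G : Digraph V} where

  suffix : (f : Vector V (suc m)) → Injective _≡_ _≡_ f →
           (∀ i → G (f (inject₁ i)) (f (suc i))) →
           ∀ i → SimplePath G (f i) (f (fromℕ m))
  suffix f f-inj f-conn zero = record
    { vertexAt = f ; first = refl ; last = refl ; distinct = f-inj ; connected = f-conn }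
  suffix {m = suc m} f f-inj f-conn (suc i) =
    suffix (f ∘ suc) (suc-injective ∘ f-inj) (f-conn ∘ suc) i

  -- If the new head already lies on the erased tail, the part before that occurrence closes a loop
  -- and `suffix` cuts it off; otherwise the head is prepended without repetition.
  loopErasure : DecidableEquality V → ∀ {u v} → Star G u v → SimplePath G u v
  loopErasure _≟ⱽ_ {u} ε = record
    { length = 0 ; vertexAt = λ _ → u ; first = refl ; last = refl
    ; distinct = λ { {zero} {zero} _ → refl } ; connected = λ () }
  loopErasure _≟ⱽ_ {u} {v} (e ◅ es) = prepend (any? (λ i → f i ≟ⱽ u))
    where
    open SimplePath (loopErasure _≟ⱽ_ es) renaming (vertexAt to f)
    prepend : _ → SimplePath G u v
    prepend (yes (i , fi≡u)) = subst₂ (SimplePath G) fi≡u last (suffix f distinct connected i)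
    prepend (no u∉f) = record
      { vertexAt  = g ; first = refl ; last = last ; distinct = g-inj
      ; connected = λ { zero → subst (G u) (sym first) e ; (suc i) → connected i } }
      where
      g : Vector V (suc (suc length))
      g zero    = u
      g (suc i) = f i
      g-inj : Injective _≡_ _≡_ g
      g-inj {zero}  {zero}  _  = refl
      g-inj {zero}  {suc j} eq = contradiction (j , sym eq) u∉f
      g-inj {suc i} {zero}  eq = contradiction (i , eq) u∉f
      g-inj {suc i} {suc j} eq = cong suc (distinct eq)

  closeCycle : ∀ {u v} → G u v → SimplePath G v u →
               ∃ λ (C₀ : DirectedCycle G) → cycleGraph C₀ u v
  closeCycle {u} {v} e p =
      record { length-1 = length ; vertexAt = vertexAt ; distinct = distinct ; connected = step }
    -- The closing edge is the one that wraps around from the last index to `zero`.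
    , fromℕ length , sym last , trans (sym first) (cong vertexAt (sym (next-fromℕ length)))
    where
    open SimplePath p
    step : ∀ i → G (vertexAt i) (vertexAt (next i))
    step i with view i
    ... | ‵fromℕ     = subst₂ G (sym last)
                         (trans (sym first) (cong vertexAt (sym (next-fromℕ length)))) e
    ... | ‵inject₁ j = subst (G (vertexAt (inject₁ j)) ∘ vertexAt) (sym (next-inject₁ j)) (connected j)

fold-injective : {A : Set} {f : A → A} → Injective _≡_ _≡_ f →
                 ∀ i {x y} → fold x f i ≡ fold y f i → x ≡ y
fold-injective f-inj zero    eq = eq
fold-injective f-inj (suc i) eq = fold-injective f-inj i (f-inj eq)

-- Two of the iterates with exponents from `0` to `m` coincide, and injectivity cancels the common
-- applications. Counting from `f j` ensures at least one step, even at a fixed point.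
orbit-returns : {f : Fin m → Fin m} → Injective _≡_ _≡_ f → ∀ j → ∃ λ t → fold (f j) f t ≡ j
orbit-returns {m} {f} f-inj j
  with i , i′ , i<i′ , eq ← pigeonhole (n<1+n m) (λ i → fold j f (toℕ i))
  with t , 1+i+t≡i′ ← m≤n⇒∃[o]m+o≡n i<i′
  = t , (begin
    fold (f j) f t     ≡⟨ fold-+ j f t ⟨
    fold j f (t + 1)   ≡⟨ fold-injective f-inj (toℕ i) (begin
      fold (fold j f (t + 1)) f (toℕ i)  ≡⟨ fold-+ j f (toℕ i) ⟨
      fold j f (toℕ i + (t + 1))         ≡⟨ cong (fold j f) (+-shift (toℕ i) t) ⟩
      fold j f (suc (toℕ i) + t)         ≡⟨ cong (fold j f) 1+i+t≡i′ ⟩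
      fold j f (toℕ i′)                  ≡⟨ eq ⟨
      fold j f (toℕ i)                   ∎) ⟩
    j                  ∎)
  where
  +-shift : ∀ i t → i + (t + 1) ≡ suc i + t
  +-shift = solve-∀

-- The orbit of `j` under `σ` yields a walk from the end of the edge back to its start. Repeated
-- digits may make this walk revisit vertices, hence the loop erasure before closing up.
edge-on-cycle : (p : Permutiple n b) → ∀ {u v} → graph p u v →
                ∃ λ (C₀ : DirectedCycle (graph p)) → cycleGraph C₀ u v
edge-on-cycle p (j , refl , refl)
  with t , returns ← orbit-returns (Injection.injective (↔⇒↣ (Permutiple.σ p))) j
  = closeCycle (j , refl , refl)
      (loopErasure _≟_ (subst (Star (graph p) _ ∘ digit) returns (walk t)))
  where
  open Permutiple p
  walk : ∀ {i} t → Star (graph p) (digit i) (digit (fold i (σ ⟨$⟩ʳ_) t))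
  walk zero    = ε
  walk (suc t) = walk t ◅◅ (_ , refl , refl) ◅ ε

-- Carries

-- `Transition`, with both sides moved so that no subtraction occurs.
Step : State n → State n → Digit b → Digit b → Set
Step {n} {b} c₁ c₂ d₁ d₂ = n * toℕ d₂ + toℕ c₁ ≡ toℕ d₁ + b * toℕ c₂

module _ (c₁ c₂ : State n) (d₁ d₂ : Digit b) where

  private
    ℤ-lhs : ℤ.+ (n * toℕ d₂ + toℕ c₁) ≡ ℤ.+ n ℤ.* ℤ.+ toℕ d₂ ℤ.+ ℤ.+ toℕ c₁
    ℤ-lhs = cong (ℤ._+ ℤ.+ toℕ c₁) (ℤ.pos-* n (toℕ d₂))

    ℤ-rhs : ℤ.+ (toℕ d₁ + b * toℕ c₂) ≡ ℤ.+ toℕ d₁ ℤ.+ ℤ.+ b ℤ.* ℤ.+ toℕ c₂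
    ℤ-rhs = cong (ℤ._+_ (ℤ.+ toℕ d₁)) (ℤ.pos-* b (toℕ c₂))

  Step⇒Transition : Step c₁ c₂ d₁ d₂ → Transition c₁ c₂ (d₁ , d₂)
  Step⇒Transition eq = begin
    N ℤ.- D ℤ.+ C         ≡⟨ swap N D C ⟩
    N ℤ.+ C ℤ.- D         ≡⟨ cong (ℤ._- D) (trans (sym ℤ-lhs) (trans (cong ℤ.+_ eq) ℤ-rhs)) ⟩
    D ℤ.+ B ℤ.- D         ≡⟨ cancel D B ⟩
    B                     ∎
    where
    N = ℤ.+ n ℤ.* ℤ.+ toℕ d₂
    D = ℤ.+ toℕ d₁
    C = ℤ.+ toℕ c₁
    B = ℤ.+ b ℤ.* ℤ.+ toℕ c₂
    swap : ∀ N D C → N ℤ.- D ℤ.+ C ≡ N ℤ.+ C ℤ.- D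
    swap = ℤ.solve-∀
    cancel : ∀ D B → D ℤ.+ B ℤ.- D ≡ B
    cancel = ℤ.solve-∀

  Transition⇒Step : Transition c₁ c₂ (d₁ , d₂) → Step c₁ c₂ d₁ d₂
  Transition⇒Step eq = ℤ.+-injective (begin
    ℤ.+ (n * toℕ d₂ + toℕ c₁)   ≡⟨ ℤ-lhs ⟩
    N ℤ.+ C                     ≡⟨ expand N D C ⟩
    D ℤ.+ (N ℤ.- D ℤ.+ C)       ≡⟨ cong (ℤ._+_ D) eq ⟩
    D ℤ.+ ℤ.+ b ℤ.* ℤ.+ toℕ c₂  ≡⟨ ℤ-rhs ⟨
    ℤ.+ (toℕ d₁ + b * toℕ c₂)   ∎)
    where
    N = ℤ.+ n ℤ.* ℤ.+ toℕ d₂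
    D = ℤ.+ toℕ d₁
    C = ℤ.+ toℕ c₁
    expand : ∀ N D C → N ℤ.+ C ≡ D ℤ.+ (N ℤ.- D ℤ.+ C)
    expand = ℤ.solve-∀

remainder-unique : ∀ {m c u v} .{{_ : NonZero b}} → c < b → m + b * u ≡ c + b * v → m % b ≡ c
remainder-unique {b} {m} {c} {u} {v} c<b eq = begin
  m % b              ≡⟨ [m+kn]%n≡m%n m u b ⟨
  (m + u * b) % b    ≡⟨ cong (λ x → (m + x) % b) (*-comm u b) ⟩
  (m + b * u) % b    ≡⟨ cong (_% b) eq ⟩
  (c + b * v) % b    ≡⟨ cong (λ x → (c + x) % b) (*-comm b v) ⟩
  (c + v * b) % b    ≡⟨ [m+kn]%n≡m%n c v b ⟩
  c % b              ≡⟨ m<n⇒m%n≡m c<b ⟩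
  c                  ∎

opposite-+ : (i : Fin m) → toℕ (opposite i) + suc (toℕ i) ≡ m
opposite-+ i = trans (cong (_+ suc (toℕ i)) (opposite-prop i)) (m∸n+n≡m (toℕ<n i))

-- Both sides are complemented with respect to the same number: `n * (b - 1) + (n - 1)` and
-- `(b - 1) + b * (n - 1)` both equal `n * b - 1`.
Step-opposite : {c₁ c₂ : State n} {d₁ d₂ : Digit b} → Step c₁ c₂ d₁ d₂ →
                Step (opposite c₁) (opposite c₂) (opposite d₁) (opposite d₂)
Step-opposite {n} {b} {c₁} {c₂} {d₁} {d₂} eq =
  -- The added term pairs every digit and state with its complement, up to `b` or `n`; a spare `b`
  -- remains on the left and a spare `n` on the right.
  +-cancelʳ-≡ (n * y + x + suc (n + b)) _ _ (begin
    n * y′ + x′ + (n * y + x + suc (n + b))   ≡⟨ lhs n y′ x′ y x b ⟩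
    n * (y′ + suc y) + (x′ + suc x) + b
      ≡⟨ cong₂ (λ p q → n * p + q + b) (opposite-+ d₂) (opposite-+ c₁) ⟩
    n * b + n + b                             ≡⟨ mid n b ⟩
    b + b * n + n
      ≡⟨ cong₂ (λ p q → p + b * q + n) (opposite-+ d₁) (opposite-+ c₂) ⟨
    z′ + suc z + b * (w′ + suc w) + n         ≡⟨ rhs b z′ z w′ w n ⟩
    z′ + b * w′ + (z + b * w + suc (n + b))
      ≡⟨ cong (λ p → z′ + b * w′ + (p + suc (n + b))) eq ⟨
    z′ + b * w′ + (n * y + x + suc (n + b))   ∎)
  where
  x = toℕ c₁ ; x′ = toℕ (opposite c₁)
  y = toℕ d₂ ; y′ = toℕ (opposite d₂)
  z = toℕ d₁ ; z′ = toℕ (opposite d₁)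
  w = toℕ c₂ ; w′ = toℕ (opposite c₂)
  lhs : ∀ n y′ x′ y x b → n * y′ + x′ + (n * y + x + suc (n + b)) ≡
        n * (y′ + suc y) + (x′ + suc x) + b
  lhs = solve-∀
  mid : ∀ n b → n * b + n + b ≡ b + b * n + n
  mid = solve-∀
  rhs : ∀ b z′ z w′ w n → z′ + suc z + b * (w′ + suc w) + n ≡
        z′ + b * w′ + (z + b * w + suc (n + b))
  rhs = solve-∀

-- Modulo `b` the tested number is `d₁ - n * d₂`, which the step makes congruent to `c₁`. As
-- `c₁ < n ≤ b`, its residue is `c₁` itself.
Step⇒motherGraph : n ≤ b → {c₁ c₂ : State n} {d₁ d₂ : Digit b} →
                   Step c₁ c₂ d₁ d₂ → motherGraph n b d₁ d₂
Step⇒motherGraph {n} {b} n≤b {c₁} {c₂} {d₁} {d₂} eq =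
  subst (_≤ n ∸ 1) (sym (remainder-unique {u = toℕ c₂} {v = toℕ d₂} (<-≤-trans (toℕ<n c₁) n≤b) (begin
    x + (b ∸ n) * y + b * toℕ c₂     ≡⟨ swap x ((b ∸ n) * y) (b * toℕ c₂) ⟩
    x + b * toℕ c₂ + (b ∸ n) * y     ≡⟨ cong (_+ (b ∸ n) * y) eq ⟨
    n * y + c + (b ∸ n) * y          ≡⟨ gather n (b ∸ n) c y ⟩
    c + (n + (b ∸ n)) * y            ≡⟨ cong (λ b → c + b * y) (m+[n∸m]≡n n≤b) ⟩
    c + b * y                        ∎)))
    (toℕ≤n∸1 c₁)
  where
  instance
    b≢0 : NonZero b
    b≢0 = nonZeroIndex d₁
  x = toℕ d₁
  y = toℕ d₂
  c = toℕ c₁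
  toℕ≤n∸1 : ∀ {n} (i : Fin n) → toℕ i ≤ n ∸ 1
  toℕ≤n∸1 {suc _} i = toℕ≤pred[n] i
  swap : ∀ x y z → x + y + z ≡ x + z + y
  swap = solve-∀
  gather : ∀ n e c y → n * y + c + e * y ≡ c + (n + e) * y
  gather = solve-∀

-- The label fixes `c₁` modulo `b`, hence outright because states lie below `n ≤ b`; cancelling `b`
-- then fixes `c₂`.
Step-unique : n ≤ b → {c₁ c₂ c₁′ c₂′ : State n} {d₁ d₂ : Digit b} →
              Step c₁ c₂ d₁ d₂ → Step c₁′ c₂′ d₁ d₂ → c₁ ≡ c₁′ × c₂ ≡ c₂′
Step-unique {n} {b} n≤b {c₁} {c₂} {c₁′} {c₂′} {d₁} {d₂} eq eq′ = c₁≡c₁′ ,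
  toℕ-injective (*-cancelˡ-≡ _ _ b (+-cancelˡ-≡ (toℕ d₁) _ _ (begin
    toℕ d₁ + b * toℕ c₂        ≡⟨ eq ⟨
    n * toℕ d₂ + toℕ c₁        ≡⟨ cong (λ c → n * toℕ d₂ + toℕ c) c₁≡c₁′ ⟩
    n * toℕ d₂ + toℕ c₁′       ≡⟨ eq′ ⟩
    toℕ d₁ + b * toℕ c₂′       ∎)))
  where
  instance
    b≢0 : NonZero b
    b≢0 = nonZeroIndex d₁
  c₁≡c₁′ : c₁ ≡ c₁′
  c₁≡c₁′ = toℕ-injective (begin
    toℕ c₁         ≡⟨ m<n⇒m%n≡m (<-≤-trans (toℕ<n c₁) n≤b) ⟨
    toℕ c₁ % b
      ≡⟨ remainder-unique {u = toℕ c₂′} {v = toℕ c₂} (<-≤-trans (toℕ<n c₁′) n≤b)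
           -- The two steps are added crosswise, so the common label contributes the same amount to
           -- both sides.
           (+-cancelˡ-≡ (n * toℕ d₂ + toℕ d₁) _ _ (begin
             n * toℕ d₂ + toℕ d₁ + (toℕ c₁ + b * toℕ c₂′)
               ≡⟨ exchange (n * toℕ d₂) (toℕ d₁) (toℕ c₁) (b * toℕ c₂′) ⟩
             n * toℕ d₂ + toℕ c₁ + (toℕ d₁ + b * toℕ c₂′)
               ≡⟨ cong₂ _+_ eq (sym eq′) ⟩
             toℕ d₁ + b * toℕ c₂ + (n * toℕ d₂ + toℕ c₁′)
               ≡⟨ exchange′ (n * toℕ d₂) (toℕ d₁) (toℕ c₁′) (b * toℕ c₂) ⟩
             n * toℕ d₂ + toℕ d₁ + (toℕ c₁′ + b * toℕ c₂)   ∎)) ⟩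
    toℕ c₁′        ∎)
    where
    exchange : ∀ p q r s → p + q + (r + s) ≡ p + r + (q + s)
    exchange = solve-∀
    exchange′ : ∀ p q r s → q + s + (p + r) ≡ p + q + (r + s)
    exchange′ = solve-∀

-- Carry sequences of a whole multiplication

value-suc : (x : Vector (Digit b) (suc m)) → value x ≡ toℕ (x zero) + b * value (tail x)
value-suc {b} x = cong₂ _+_ (*-identityʳ _) (begin
  sum (λ j → toℕ (tail x j) * (b * b ^ toℕ j))
    ≡⟨ sum-cong-≗ (λ j → swap (toℕ (tail x j)) b (b ^ toℕ j)) ⟩
  sum (λ j → b * (toℕ (tail x j) * b ^ toℕ j))
    ≡⟨ *-distribˡ-sum b (λ j → toℕ (tail x j) * b ^ toℕ j) ⟨
  b * value (tail x)                             ∎)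
  where
  swap : ∀ x b e → x * (b * e) ≡ b * (x * e)
  swap = solve-∀

-- Schoolbook multiplication from the lowest digit upwards. Incoming and outgoing carries are
-- arbitrary for the sake of the induction; `c′` is a mere natural number because its being a state
-- is part of the conclusion.
carries : (x y : Vector (Digit b) m) (c : State n) (c′ : ℕ) →
          n * value y + toℕ c ≡ value x + b ^ m * c′ →
          ∃ λ (s : Vector (State n) (suc m)) →
            s zero ≡ c × toℕ (s (fromℕ m)) ≡ c′ ×
            ∀ j → Step (s (inject₁ j)) (s (suc j)) (x j) (y j)
carries {m = zero} {n} x y c c′ eq = (λ _ → c) , refl , (begin
  toℕ c           ≡⟨ cong (_+ toℕ c) (*-zeroʳ n) ⟨
  n * 0 + toℕ c   ≡⟨ eq ⟩
  1 * c′          ≡⟨ *-identityˡ c′ ⟩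
  c′              ∎) , λ ()
carries {b} {m = suc m} {n} x y c c′ eq =
  s , refl , proj₁ (proj₂ (proj₂ rec)) , steps
  where
  instance
    b≢0 : NonZero b
    b≢0 = nonZeroIndex (x zero)
  t : ℕ
  t = n * toℕ (y zero) + toℕ c
  -- From `y zero ≤ b - 1` and `c < n`; hence the outgoing carry `t / b` is below `n`, that is, a
  -- state.
  t<n*b : t < n * b
  t<n*b = <-≤-trans (+-monoʳ-< (n * toℕ (y zero)) (toℕ<n c))
    (subst (_≤ n * b) (*-suc-comm n (toℕ (y zero))) (*-monoʳ-≤ n (toℕ<n (y zero))))
    where
    *-suc-comm : ∀ n y → n * suc y ≡ n * y + n
    *-suc-comm = solve-∀
  c₁ : State n
  c₁ = fromℕ< (m<n*o⇒m/o<n t<n*b)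
  -- The lowest column is split off. Read modulo `b`, this identifies `x zero` as `t % b`; with that
  -- column subtracted and `b` cancelled, it is the same problem for the tails.
  eq⁺ : t + b * (n * value (tail y)) ≡ toℕ (x zero) + b * (value (tail x) + b ^ m * c′)
  eq⁺ = begin
    t + b * (n * value (tail y))
      ≡⟨ lhs n (toℕ (y zero)) (toℕ c) b (value (tail y)) ⟩
    n * (toℕ (y zero) + b * value (tail y)) + toℕ c
      ≡⟨ cong (λ v → n * v + toℕ c) (value-suc y) ⟨
    n * value y + toℕ c
      ≡⟨ eq ⟩
    value x + b ^ suc m * c′
      ≡⟨ cong (_+ b ^ suc m * c′) (value-suc x) ⟩
    toℕ (x zero) + b * value (tail x) + b * b ^ m * c′
      ≡⟨ rhs (toℕ (x zero)) b (value (tail x)) (b ^ m) c′ ⟩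
    toℕ (x zero) + b * (value (tail x) + b ^ m * c′) ∎
    where
    lhs : ∀ n y c b v → n * y + c + b * (n * v) ≡ n * (y + b * v) + c
    lhs = solve-∀
    rhs : ∀ x b v e c → x + b * v + b * e * c ≡ x + b * (v + e * c)
    rhs = solve-∀
  step₀ : Step c c₁ (x zero) (y zero)
  step₀ = begin
    t                          ≡⟨ m≡m%n+[m/n]*n t b ⟩
    t % b + t / b * b
      ≡⟨ cong₂ _+_ (remainder-unique {u = n * value (tail y)} (toℕ<n (x zero)) eq⁺)
                   (*-comm (t / b) b) ⟩
    toℕ (x zero) + b * (t / b) ≡⟨ cong (λ c → toℕ (x zero) + b * c) (toℕ-fromℕ< _) ⟨
    toℕ (x zero) + b * toℕ c₁  ∎
  eq′ : n * value (tail y) + toℕ c₁ ≡ value (tail x) + b ^ m * c′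
  eq′ = *-cancelˡ-≡ _ _ b (+-cancelˡ-≡ (toℕ (x zero)) _ _ (begin
    toℕ (x zero) + b * (n * value (tail y) + toℕ c₁)
      ≡⟨ split (toℕ (x zero)) b (n * value (tail y)) (toℕ c₁) ⟩
    toℕ (x zero) + b * toℕ c₁ + b * (n * value (tail y))
      ≡⟨ cong (_+ b * (n * value (tail y))) step₀ ⟨
    t + b * (n * value (tail y))
      ≡⟨ eq⁺ ⟩
    toℕ (x zero) + b * (value (tail x) + b ^ m * c′) ∎))
    where
    split : ∀ x b v c → x + b * (v + c) ≡ x + b * c + b * v
    split = solve-∀
  rec = carries (tail x) (tail y) c₁ c′ eq′
  s : Vector (State n) (suc (suc m))
  s zero    = c
  s (suc i) = proj₁ rec i
  steps : ∀ j → Step (s (inject₁ j)) (s (suc j)) (x j) (y j)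
  steps zero    = subst (λ c₁ → Step c c₁ (x zero) (y zero)) (sym (proj₁ (proj₂ rec))) step₀
  steps (suc j) = proj₂ (proj₂ (proj₂ rec)) j

-- Converse of `carries`: weighted by powers of `b`, the steps telescope and only the first and last
-- carries survive. The induction does this by Horner's rule.
carries-value : (x y : Vector (Digit b) m) (s : Vector (State n) (suc m)) →
                (∀ j → Step (s (inject₁ j)) (s (suc j)) (x j) (y j)) →
                n * value y + toℕ (s zero) ≡ value x + b ^ m * toℕ (s (fromℕ m))
carries-value {m = zero} {n} x y s steps = begin
  n * 0 + toℕ (s zero)   ≡⟨ cong (_+ toℕ (s zero)) (*-zeroʳ n) ⟩
  toℕ (s zero)           ≡⟨ *-identityˡ _ ⟨
  1 * toℕ (s zero)       ∎
carries-value {b} {m = suc m} {n} x y s steps = begin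
  n * value y + toℕ (s zero)
    ≡⟨ cong (λ v → n * v + toℕ (s zero)) (value-suc y) ⟩
  n * (toℕ (y zero) + b * value (tail y)) + toℕ (s zero)
    ≡⟨ lhs n (toℕ (y zero)) b (value (tail y)) (toℕ (s zero)) ⟩
  n * toℕ (y zero) + toℕ (s zero) + b * (n * value (tail y))
    ≡⟨ cong (_+ b * (n * value (tail y))) (steps zero) ⟩
  toℕ (x zero) + b * toℕ (s (suc zero)) + b * (n * value (tail y))
    ≡⟨ mid (toℕ (x zero)) b (toℕ (s (suc zero))) (n * value (tail y)) ⟩
  toℕ (x zero) + b * (n * value (tail y) + toℕ (s (suc zero)))
    ≡⟨ cong (λ v → toℕ (x zero) + b * v) (carries-value (tail x) (tail y) (tail s) (steps ∘ suc)) ⟩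
  toℕ (x zero) + b * (value (tail x) + b ^ m * toℕ (s (fromℕ (suc m))))
    ≡⟨ rhs (toℕ (x zero)) b (value (tail x)) (b ^ m) _ ⟩
  toℕ (x zero) + b * value (tail x) + b ^ suc m * toℕ (s (fromℕ (suc m)))
    ≡⟨ cong (_+ b ^ suc m * toℕ (s (fromℕ (suc m)))) (value-suc x) ⟨
  value x + b ^ suc m * toℕ (s (fromℕ (suc m))) ∎
  where
  lhs : ∀ n y b v c → n * (y + b * v) + c ≡ n * y + c + b * (n * v)
  lhs = solve-∀
  mid : ∀ x b c v → x + b * c + b * v ≡ x + b * (v + c)
  mid = solve-∀
  rhs : ∀ x b v e c → x + b * (v + e * c) ≡ x + b * v + b * e * c
  rhs = solve-∀

-- There is one state per digit: the step at the last index leads back to `c zero`, which says that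
-- no carry is left over at the top. In this form `step` is insensitive to rotation, and only
-- `initial` marks where the number starts.
record CyclicCarries (x y : Vector (Digit b) (suc m)) (c : Vector (State n) (suc m)) : Set where
  field
    initial : toℕ (c zero) ≡ 0
    step    : ∀ j → Step (c j) (c (next j)) (x j) (y j)

cyclicCarries : 0 < n → (x y : Vector (Digit b) (suc m)) → value x ≡ n * value y →
                ∃ λ (c : Vector (State n) (suc m)) → CyclicCarries x y c
cyclicCarries {n@(suc _)} {b} {m} _ x y eq = close (carries x y zero 0 (begin
    n * value y + 0         ≡⟨ +-identityʳ _ ⟩
    n * value y             ≡⟨ eq ⟨
    value x                 ≡⟨ +-identityʳ _ ⟨
    value x + 0             ≡⟨ cong (value x +_) (*-zeroʳ (b ^ suc m)) ⟨
    value x + b ^ suc m * 0 ∎))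
  where
  -- The linear chain has one state more than there are digits; its end equals its start and is
  -- identified with index `zero`.
  wrap : (s : Vector (State n) (suc (suc m))) → s (fromℕ (suc m)) ≡ s zero →
         ∀ j → s (suc j) ≡ s (inject₁ (next j))
  wrap s last≡first j with view j
  ... | ‵fromℕ     = trans last≡first (cong (s ∘ inject₁) (sym (next-fromℕ m)))
  ... | ‵inject₁ i = cong (s ∘ inject₁) (sym (next-inject₁ i))
  close : (∃ λ (s : Vector (State n) (suc (suc m))) →
             s zero ≡ zero × toℕ (s (fromℕ (suc m))) ≡ 0 ×
             ∀ j → Step (s (inject₁ j)) (s (suc j)) (x j) (y j)) →
          ∃ λ (c : Vector (State n) (suc m)) → CyclicCarries x y c
  close (s , s0≡0 , last≡0 , steps) = s ∘ inject₁ , record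
    { initial = cong toℕ s0≡0
    ; step    = λ j → subst (λ c → Step (s (inject₁ j)) c (x j) (y j))
                        (wrap s (toℕ-injective (trans last≡0 (sym (cong toℕ s0≡0)))) j)
                        (steps j) }

cyclicCarries-value : {x y : Vector (Digit b) (suc m)} {c : Vector (State n) (suc m)} →
                      CyclicCarries x y c → value x ≡ n * value y
cyclicCarries-value {b} {m} {n} {x} {y} {c} cc = begin
  value x
    ≡⟨ +-identityʳ _ ⟨
  value x + 0
    ≡⟨ cong (value x +_) (*-zeroʳ (b ^ suc m)) ⟨
  value x + b ^ suc m * 0
    ≡⟨ cong (λ c → value x + b ^ suc m * c) (trans (cong (toℕ ∘ c) (next-fromℕ m)) initial) ⟨
  value x + b ^ suc m * toℕ (s (fromℕ (suc m)))
    ≡⟨ carries-value x y s (λ j →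
         subst (λ c₁ → Step c₁ (s (suc j)) (x j) (y j)) (sym (s-inject₁ j)) (step j)) ⟨
  n * value y + toℕ (c zero)
    ≡⟨ cong (n * value y +_) initial ⟩
  n * value y + 0
    ≡⟨ +-identityʳ _ ⟩
  n * value y ∎
  where
  open CyclicCarries cc
  -- The cyclic sequence is cut open: its extra last entry is `c (next (fromℕ m))`, which is
  -- `c zero` again.
  s : Vector (State n) (suc (suc m))
  s zero    = c zero
  s (suc i) = c (next i)
  s-inject₁ : ∀ j → s (inject₁ j) ≡ c j
  s-inject₁ zero    = refl
  s-inject₁ (suc j) = cong c (next-inject₁ j)

-- The class and its reflection

permutedDigit : (p : Permutiple n b) → Vector (Digit b) (suc (Permutiple.k p))
permutedDigit p j = digit (σ ⟨$⟩ʳ j)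
  where open Permutiple p

permutipleCarries : 0 < n → (p : Permutiple n b) →
                    ∃ λ c → CyclicCarries (Permutiple.digit p) (permutedDigit p) c
permutipleCarries 0<n p = cyclicCarries 0<n digit (permutedDigit p) value≡n*permuted
  where open Permutiple p

graph⊆motherGraph : 0 < n → n ≤ b → (p : Permutiple n b) → graph p ⊆ᴳ motherGraph n b
graph⊆motherGraph 0<n n≤b p (j , refl , refl) with c , cc ← permutipleCarries 0<n p =
  Step⇒motherGraph n≤b {c j} {c (next j)} (CyclicCarries.step cc j)

mapCycle : {V : Set} {G H : Digraph V} → G ⊆ᴳ H → DirectedCycle G → DirectedCycle H
mapCycle G⊆H C₀ = record
  { vertexAt = vertexAt ; distinct = distinct ; connected = λ i → G⊆H (connected i) }
  where open DirectedCycle C₀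

-- The label lies on a directed cycle inside the class graph, which is also a cycle of the mother
-- graph, and the image of that cycle contains the step.
step⇒vertex : 0 < n → n ≤ b → (C : PermutipleClass n b) {c₁ c₂ : State n} {d₁ d₂ : Digit b} →
              classGraph C d₁ d₂ → Step c₁ c₂ d₁ d₂ → vertex (classStateGraph C) c₁
step⇒vertex {n} {b} 0<n n≤b C {c₁} {c₂} {d₁} {d₂} e st
  with C₀ , on-cycle ← edge-on-cycle (PermutipleClass.root C) e
  = (mapCycle G⊆M C₀ , λ { (i , refl , refl) → DirectedCycle.connected C₀ i })
  , c₁ , c₂
  , ((d₁ , d₂) , on-cycle , G⊆M e , Step⇒Transition c₁ c₂ d₁ d₂ st)
  , inj₁ refl
  where
  G⊆M : classGraph C ⊆ᴳ motherGraph n b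
  G⊆M = graph⊆motherGraph 0<n n≤b (PermutipleClass.root C)

-- A label in one of the cycle images is an edge of the class graph, so it occurs at some column
-- `j`. By `Step-unique` the edge it labels is the carry step of that column, so both endpoints are
-- carries.
vertex⇒carry : n ≤ b → (C : PermutipleClass n b) →
               let p = PermutipleClass.root C in
               ∀ {c} → CyclicCarries (Permutiple.digit p) (permutedDigit p) c →
               ∀ {v} → vertex (classStateGraph C) v → ∃ λ r → c r ≡ v
vertex⇒carry n≤b C {c} cc ((C₀ , C₀⊆G) , c₁ , c₂ , ((d₁ , d₂) , on-cycle , _ , tr) , endpoint)
  with C₀⊆G on-cycle
... | j , refl , refl
  with Step-unique n≤b (CyclicCarries.step cc j) (Transition⇒Step c₁ c₂ d₁ d₂ tr) | endpoint
... | c≡c₁ , _ | inj₁ refl = j , c≡c₁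
... | _ , c≡c₂ | inj₂ refl = next j , c≡c₂

-- Rotating the digits to start at index r makes the reflection of the carry
-- c r the initial one.
reflectedPermutiple : (p : Permutiple n b) →
                      ∀ {c} → CyclicCarries (Permutiple.digit p) (permutedDigit p) c →
                      ∀ r → toℕ (opposite (c r)) ≡ 0 →
                      ∃ λ (q : Permutiple n b) → graph q ≐ᴳ reflect (graph p)
reflectedPermutiple {n} {b} p {c} cc r initial
  with ρ , ρ0≡r , ρ-next ← rotation r = reflected ρ ρ0≡r ρ-next
  where
  open Permutiple p
  reflected : (ρ : Permutation′ (suc k)) → ρ ⟨$⟩ʳ zero ≡ r →
              (∀ i → ρ ⟨$⟩ʳ next i ≡ next (ρ ⟨$⟩ʳ i)) →
              ∃ λ (q : Permutiple n b) → graph q ≐ᴳ reflect (graph p)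
  reflected ρ ρ0≡r ρ-next = q , q⊆p , p⊆q
    where
    digit′ : Vector (Digit b) (suc k)
    digit′ i = opposite (digit (ρ ⟨$⟩ʳ i))
    -- Since `∘ₚ` composes from left to right, this is the conjugate of `σ` that sends `i` to the
    -- `ρ`-preimage of `σ` at `ρ i`; thus `digit′` at `σ′ i` is the reflected permuted digit at
    -- `ρ i`.
    σ′ : Permutation′ (suc k)
    σ′ = ρ ∘ₚ σ ∘ₚ flip ρ
    c′ : Vector (State n) (suc k)
    c′ i = opposite (c (ρ ⟨$⟩ʳ i))
    digit′-σ′ : ∀ i → digit′ (σ′ ⟨$⟩ʳ i) ≡ opposite (permutedDigit p (ρ ⟨$⟩ʳ i))
    digit′-σ′ i = cong (opposite ∘ digit) (inverseʳ ρ)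
    step′ : ∀ i → Step (c′ i) (c′ (next i)) (digit′ i) (digit′ (σ′ ⟨$⟩ʳ i))
    step′ i = subst₂ (λ c₂ d₂ → Step (c′ i) c₂ (digit′ i) d₂)
      (cong (opposite ∘ c) (sym (ρ-next i))) (sym (digit′-σ′ i))
      (Step-opposite {c₁ = c (ρ ⟨$⟩ʳ i)} {c (next (ρ ⟨$⟩ʳ i))} (CyclicCarries.step cc (ρ ⟨$⟩ʳ i)))
    q : Permutiple n b
    q = record
      { digit = digit′ ; σ = σ′
      ; value≡n*permuted = cyclicCarries-value {c = c′} record
          { initial = trans (cong (toℕ ∘ opposite ∘ c) ρ0≡r) initial ; step = step′ } }
    q⊆p : graph q ⊆ᴳ reflect (graph p)
    q⊆p (i , refl , refl) = _ , _ , (ρ ⟨$⟩ʳ i , refl , refl) , refl , digit′-σ′ i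
    p⊆q : reflect (graph p) ⊆ᴳ graph q
    p⊆q (_ , _ , (j , refl , refl) , refl , refl) =
        -- Column `j` of `p` has moved to the column of `q` that `ρ` sends to `j`.
        ρ ⟨$⟩ˡ j , cong (opposite ∘ digit) (sym (inverseʳ ρ))
      , sym (trans (digit′-σ′ (ρ ⟨$⟩ˡ j)) (cong (opposite ∘ permutedDigit p) (inverseʳ ρ)))

-- Equivalence of the three statements

toℕ-opposite≡0 : (c : State n) → toℕ c ≡ n ∸ 1 → toℕ (opposite c) ≡ 0
toℕ-opposite≡0 {n = suc n} c eq = begin
  toℕ (opposite c)   ≡⟨ opposite-prop c ⟩
  n ∸ toℕ c          ≡⟨ cong (n ∸_) eq ⟩
  n ∸ n              ≡⟨ n∸n≡0 n ⟩
  0                  ∎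

toℕ-opposite≡n∸1 : (c : State n) → toℕ c ≡ 0 → toℕ (opposite c) ≡ n ∸ 1
toℕ-opposite≡n∸1 {n = suc n} zero refl = toℕ-fromℕ n

reflect-vertex : (Γ : StateGraph n b) →
                 (0 isStateOf reflectStates Γ) ⇔ ((n ∸ 1) isStateOf Γ)
reflect-vertex {n} Γ = mk⇔
  (λ { (_ , toℕ≡0 , c , c∈Γ , refl) →
       c , subst (λ c → toℕ c ≡ n ∸ 1) (opposite-involutive c) (toℕ-opposite≡n∸1 _ toℕ≡0) , c∈Γ })
  (λ { (c , toℕ≡n∸1 , c∈Γ) → opposite c , toℕ-opposite≡0 c toℕ≡n∸1 , c , c∈Γ , refl })

reflectionPermutiple⇔ : 0 < n → n ≤ b → (C : PermutipleClass n b) →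
                        (∃ λ (q : Permutiple n b) → graph q ≐ᴳ reflect (classGraph C))
                        ⇔ ((n ∸ 1) isStateOf classStateGraph C)
reflectionPermutiple⇔ {n} {b} 0<n n≤b C = mk⇔ to from
  where
  to : (∃ λ (q : Permutiple n b) → graph q ≐ᴳ reflect (classGraph C)) →
       (n ∸ 1) isStateOf classStateGraph C
  -- Column `zero` of `q` starts from the carry `0`. Reflected, its step starts from `n ∸ 1`, and
  -- its label is an edge of the class graph.
  to (q , q⊆ , _)
    with c , cc ← permutipleCarries 0<n q
       | d₁ , d₂ , e , ≡d₁ , ≡d₂ ← q⊆ (zero , refl , refl)
    = opposite (c zero) , toℕ-opposite≡n∸1 (c zero) (CyclicCarries.initial cc)
    , step⇒vertex 0<n n≤b C {c₂ = opposite (c (next zero))} e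
        (subst₂ (Step (opposite (c zero)) (opposite (c (next zero))))
          (trans (cong opposite ≡d₁) (opposite-involutive d₁))
          (trans (cong opposite ≡d₂) (opposite-involutive d₂))
          (Step-opposite {c₁ = c zero} {c (next zero)} (CyclicCarries.step cc zero)))
  from : (n ∸ 1) isStateOf classStateGraph C →
         ∃ λ (q : Permutiple n b) → graph q ≐ᴳ reflect (classGraph C)
  -- The state `n ∸ 1` is a carry `c r` of the root, so `r` can serve as the starting index of the
  -- rotation.
  from (v , v≡n∸1 , v∈Γ)
    with c , cc ← permutipleCarries 0<n (PermutipleClass.root C)
    with r , refl ← vertex⇒carry n≤b C cc v∈Γ
    = reflectedPermutiple (PermutipleClass.root C) cc r (toℕ-opposite≡0 (c r) v≡n∸1)

theorem15 : (n b : ℕ) → 1 < n → n < b → (C : PermutipleClass n b) →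
    ((∃ λ (q : Permutiple n b) → graph q ≐ᴳ reflect (classGraph C))
    ⇔ (0 isStateOf reflectStates (classStateGraph C)))
    × ((0 isStateOf reflectStates (classStateGraph C))
    ⇔ ((n ∸ 1) isStateOf classStateGraph C))
theorem15 n b 1<n n<b C =
    -- The first equivalence is reached through statement (3).
    ⇔-trans (reflectionPermutiple⇔ (<⇒≤ 1<n) (<⇒≤ n<b) C) (⇔-sym 2⇔3) , 2⇔3
  where
  2⇔3 : (0 isStateOf reflectStates (classStateGraph C)) ⇔ ((n ∸ 1) isStateOf classStateGraph C)
  2⇔3 = reflect-vertex (classStateGraph C)
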